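{- If $T$ is a Suslin tree, then $\diamondsuit_T$ holds if and only if $\diamondsuit$ holds.
   Context: A tree is a partial order $(T,<_T)$ in which the set of predecessors of each node is well-ordered; every tree is assumed to have a root, denoted $\emptyset$. For $t\in T$, $t{\downarrow}=\{s\in T\mid s<_T t\}$, $\mathrm{ht}(t)$ is the order type of $t{\downarrow}$, and $T_\alpha$ is the set of nodes of height $\alpha$. The height of $T$ is the least $\alpha$ with $T_\alpha=\emptyset$. An $\omega_1$-tree is a tree of height $\omega_1$ all of whose levels $T_\alpha$ are countable. An antichain is a set of pairwise incomparable nodes; a cofinal branch is a chain meeting every level. A Suslin tree is an $\omega_1$-tree with no cofinal branches and no uncountable antichains. A set $U\subseteq T$ is special if it is a union of at most countably many antichains; otherwise it is nonspecial. For $X\subseteq T$, a map $f:X\to T$ is regressive if $f(t)<_T t$ for all $t\in X\setminus\{\emptyset\}$. For $T$ of height $\omega_1$, $NS^T$ is the ideal of all $B\subseteq T$ for which there is a regressive $f:B\to T$ such that $f^{ -1}(\{t\})$ is special for every $t\in T$. For a nonspecial tree $T$ of height $\omega_1$, $\diamondsuit_T$ asserts that there is a sequence $(D_t\mid t\in T)$ with $D_t\subseteq t{\downarrow}$ for all $t\in T$ such that for every $X\subseteq T$, $\{t\in T\mid X\cap t{\downarrow}=D_t\}\notin NS^T$. $\diamondsuit$ is Jensen's principle: there is $(D_\alpha)_{\alpha<\omega_1}$ with $D_\alpha\subseteq\alpha$ such that for every $X\subseteq\omega_1$ the set $\{\alpha<\omega_1\mid X\cap\alpha=D_\alpha\}$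 is stationary. -}

module Defs where

open import Data.Nat.Base using (ℕ)
open import Data.Product.Base using (Σ; ∃-syntax; _×_; proj₁)
open import Data.Sum.Base using (_⊎_)
open import Function.Base using (_on_)
open import Induction.WellFounded using (WellFounded)
open import Level using (0ℓ)
open import Relation.Binary.Core using (Rel)
open import Relation.Binary.Morphism.Structures using (IsOrderIsomorphism)
open import Relation.Binary.PropositionalEquality.Core using (_≡_; _≢_)
open import Relation.Binary.Structures using (IsStrictPartialOrder; IsStrictTotalOrder)
open import Relation.Nullary.Negation.Core using (¬_)
open import Relation.Unary using (Pred; _∈_; _⊆_; _≐_; _∩_; ⋃; U; Satisfiable)

-- Subsets of A are predicates Pred A 0ℓ, compared by extensional equality _≐_.
-- A subset P viewed as a structure in its own right is the type Σ A P, with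
-- equality and order taken on first projections, so that proofs of membership
-- are immaterial.

-- At most countable.  The values of the injection outside P are irrelevant.
Countable : {A : Set} → Pred A 0ℓ → Set
Countable {A} P =
  Σ (A → ℕ) λ f → ∀ {x y} → x ∈ P → y ∈ P → f x ≡ f y → x ≡ y

WellOrderedOn : {A : Set} → Rel A 0ℓ → Pred A 0ℓ → Set
WellOrderedOn {A} _<_ P =
    IsStrictTotalOrder {A = Σ A P} (_≡_ on proj₁) (_<_ on proj₁)
  × WellFounded {A = Σ A P} (_<_ on proj₁)

SameOrderType : {A B : Set} → Rel A 0ℓ → Pred A 0ℓ → Rel B 0ℓ → Pred B 0ℓ → Set
SameOrderType {A} {B} _<₁_ P _<₂_ Q =
  Σ (Σ A P → Σ B Q)
    (IsOrderIsomorphism (_≡_ on proj₁) (_≡_ on proj₁) (_<₁_ on proj₁) (_<₂_ on proj₁))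

-- The ordinal ω₁, up to isomorphism: an uncountable well-order all of whose
-- proper initial segments are countable.
record Omega₁ : Set₁ where
  infix 4 _<_
  field
    Carrier     : Set
    _<_         : Rel Carrier 0ℓ
    wellOrdered : WellOrderedOn _<_ U
    uncountable : ¬ Countable {Carrier} U
    segments    : ∀ α → Countable (_< α)

module _ (Ω : Omega₁) where
  open Omega₁ Ω renaming (Carrier to Ord)

  Unbounded : Pred Ord 0ℓ → Set
  Unbounded C = ∀ α → ∃[ β ] (β ∈ C × α < β)

  -- α belongs to C whenever α is nonzero and C ∩ α is unbounded in α
  -- (such an α is necessarily a limit).
  Closed : Pred Ord 0ℓ → Set
  Closed C = ∀ α → Satisfiable (_< α) →
             (∀ β → β < α → ∃[ γ ] (γ ∈ C × β < γ × γ < α)) → α ∈ C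

  Club : Pred Ord 0ℓ → Set
  Club C = Closed C × Unbounded C

  Stationary : Pred Ord 0ℓ → Set₁
  Stationary S = ∀ C → Club C → Satisfiable (S ∩ C)

  ◇ : Set₁
  ◇ = Σ (Ord → Pred Ord 0ℓ) λ D →
        (∀ α → D α ⊆ (_< α))
      × (∀ (X : Pred Ord 0ℓ) → Stationary (λ α → (X ∩ (_< α)) ≐ D α))

record Tree : Set₁ where
  infix 4 _<_
  field
    Node                 : Set
    _<_                  : Rel Node 0ℓ
    isStrictPartialOrder : IsStrictPartialOrder _≡_ _<_
    root                 : Node
    root-least           : ∀ t → t ≢ root → root < t

  _↓ : Node → Pred Node 0ℓ
  t ↓ = _< t

  field
    ↓-wellOrdered : ∀ t → WellOrderedOn _<_ (t ↓)

module _ (T : Tree) where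
  open Tree T

  Chain : Pred Node 0ℓ → Set
  Chain A = ∀ {s t} → s ∈ A → t ∈ A → s ≢ t → s < t ⊎ t < s

  Antichain : Pred Node 0ℓ → Set
  Antichain A = ∀ {s t} → s ∈ A → t ∈ A → s ≢ t → ¬ (s < t ⊎ t < s)

  -- Finite unions are covered by letting some of the antichains be empty.
  Special : Pred Node 0ℓ → Set₁
  Special S = Σ (ℕ → Pred Node 0ℓ) λ A → (∀ n → Antichain (A n)) × S ≐ ⋃ ℕ A

  -- A map f : X → T is represented by a total map whose values outside X are
  -- irrelevant.
  Regressive : Pred Node 0ℓ → (Node → Node) → Set
  Regressive X f = ∀ {t} → t ∈ X → t ≢ root → f t < t

  -- Membership in the ideal NSᵀ.
  NS : Pred Node 0ℓ → Set₁
  NS B = Σ (Node → Node) λ f →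
           Regressive B f × (∀ t → Special (λ s → s ∈ B × f s ≡ t))

  ◇ᵀ : Set₁
  ◇ᵀ = Σ (Node → Pred Node 0ℓ) λ D →
         (∀ t → D t ⊆ t ↓)
       × (∀ (X : Pred Node 0ℓ) → ¬ NS (λ t → (X ∩ (t ↓)) ≐ D t))

  module _ (Ω : Omega₁) where
    open Omega₁ Ω using () renaming (Carrier to Ord; _<_ to _<Ω_)

    -- T_α for α < ω₁: the nodes whose predecessors have order type α.
    Level : Ord → Pred Node 0ℓ
    Level α t = SameOrderType _<_ (t ↓) _<Ω_ (_<Ω α)

    -- T_{ω₁}.
    Level-ω₁ : Pred Node 0ℓ
    Level-ω₁ t = SameOrderType _<_ (t ↓) _<Ω_ U

    -- ω₁ is the least ordinal α with T_α empty.
    HasHeight-ω₁ : Set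
    HasHeight-ω₁ = (∀ α → Satisfiable (Level α)) × ¬ Satisfiable Level-ω₁

    IsOmega₁Tree : Set
    IsOmega₁Tree = HasHeight-ω₁ × (∀ α → Countable (Level α))

    CofinalBranch : Pred Node 0ℓ → Set
    CofinalBranch b = Chain b × (∀ α → Satisfiable (b ∩ Level α))

    IsSuslin : Set₁
    IsSuslin = IsOmega₁Tree
             × ¬ (∃[ b ] CofinalBranch b)
             × ¬ (∃[ A ] (Antichain A × ¬ Countable A))

{-# OPTIONS --safe #-}
module Submission where

-- In a Suslin tree a set of nodes is special exactly when it is countable, so
-- pressing down along closure points of functions ω₁ → ω₁ shows that B ∈ NSᵀ if
-- and only if the set of heights of nodes of B is nonstationary.  Hence ◇ yields
-- ◇ᵀ by guessing, at each t, the set of s < t whose code under an injection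
-- T → ω₁ lies in D_{ht t}.  Conversely, taking the heights of the nodes in D_t for
-- all t of height α gives countably many guesses at α, that is ◇⁻, and Kunen's
-- argument extracts a single ◇-sequence.

open import Axiom.ExcludedMiddle using (ExcludedMiddle)
open import Data.Nat.Base using (ℕ; zero; _*_) renaming (_<_ to _<ℕ_)
open import Data.Nat.Induction using () renaming (<-wellFounded to <ℕ-wellFounded)
open import Data.Nat.Properties using (*-cancelˡ-≡; even≢odd; suc-injective)
  renaming (<-trans to <ℕ-trans; <-cmp to <ℕ-cmp)
open import Data.Product.Base using (Σ; ∃-syntax; _×_; _,_; proj₁; proj₂; map₂)
open import Data.Product.Relation.Binary.Lex.Strict using (×-Lex; ×-transitive; ×-wellFounded)
open import Data.Sum.Base using (_⊎_; inj₁; inj₂; [_,_]′)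
open import Data.Unit.Base using (tt)
open import Function.Base using (_on_; _∘_; id)
open import Function.Bundles using (_⇔_; mk⇔)
open import Induction.WellFounded using (Acc; acc; WellFounded; module All)
open import Level using (0ℓ; suc; _⊔_; Lift; lift; lower)
open import Relation.Binary.Core using (Rel)
open import Relation.Binary.Definitions using (Transitive; Trichotomous; tri<; tri≈; tri>)
open import Relation.Binary.Morphism.Structures using (IsOrderIsomorphism)
open import Relation.Binary.PropositionalEquality
  using (_≡_; _≢_; refl; sym; trans; subst; resp₂; isEquivalence)
open import Relation.Binary.Structures using (IsStrictPartialOrder; IsStrictTotalOrder)
open import Relation.Nullary using (¬_; Dec; yes; no; contradiction)
open import Relation.Nullary.Decidable using (map′; decidable-stable)
open import Relation.Unary using (Pred; _∈_; _∉_; _⊆_; _≐_; _∩_; _∪_; U; Satisfiable)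
open import Defs

-- Preliminaries: pairing natural numbers, countable sets.

counterexample : ∀ {a p} {A : Set a} {P : A → Set p} →
                 ExcludedMiddle (a ⊔ p) → ExcludedMiddle p →
                 ¬ (∀ x → P x) → ∃[ x ] ¬ P x
counterexample em emP ¬∀ =
  decidable-stable em λ ¬∃ → ¬∀ λ x → decidable-stable emP λ ¬p → ¬∃ (x , ¬p)

-- No descent leaves a downward closed set, so accessibility in the subtype, where the definitions
-- state well-foundedness, passes to the whole order.
Acc-Σ⇒Acc : {A : Set} {_<_ : Rel A 0ℓ} {P : Pred A 0ℓ} →
            (∀ {x y} → y < x → x ∈ P → y ∈ P) →
            ∀ {x} → Acc {A = Σ A P} (_<_ on proj₁) x → Acc _<_ (proj₁ x)
Acc-Σ⇒Acc closed {x , x∈P} (acc rs) =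
  acc λ y<x → Acc-Σ⇒Acc closed (rs {_ , closed y<x x∈P} y<x)

-- This is `2^m (2n + 1) - 1`; the parity of a value tells whether `m` is zero.
pair : ℕ → ℕ → ℕ
pair zero    n = 2 * n
pair (ℕ.suc m) n = ℕ.suc (2 * pair m n)

pair-injective : ∀ m n m′ n′ → pair m n ≡ pair m′ n′ → m ≡ m′ × n ≡ n′
pair-injective zero    n zero     n′ eq = refl , *-cancelˡ-≡ n n′ 2 eq
pair-injective zero    n (ℕ.suc m′) n′ eq = contradiction eq (even≢odd n (pair m′ n′))
pair-injective (ℕ.suc m) n zero     n′ eq = contradiction (sym eq) (even≢odd n′ (pair m n))
pair-injective (ℕ.suc m) n (ℕ.suc m′) n′ eq
  with pair-injective m n m′ n′ (*-cancelˡ-≡ _ _ 2 (suc-injective eq))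
... | refl , n≡n′ = refl , n≡n′

countable-⊆ : {A : Set} {P Q : Pred A 0ℓ} → P ⊆ Q → Countable Q → Countable P
countable-⊆ P⊆Q (f , f-inj) = f , λ x∈P y∈P → f-inj (P⊆Q x∈P) (P⊆Q y∈P)

countable-subsingleton : {A : Set} {P : Pred A 0ℓ} →
                         (∀ {x y} → x ∈ P → y ∈ P → x ≡ y) → Countable P
countable-subsingleton unique = (λ _ → 0) , λ x∈P y∈P _ → unique x∈P y∈P

countable-singleton : {A : Set} (x : A) → Countable (x ≡_)
countable-singleton x = countable-subsingleton λ p q → trans (sym p) q

countable-ℕ : Countable {ℕ} U
countable-ℕ = id , λ _ _ → id

module Classical (em₁ : ExcludedMiddle (suc 0ℓ)) where

  em₀ : ExcludedMiddle 0ℓ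
  em₀ {P} = map′ lower lift (em₁ {Lift (suc 0ℓ) P})

  abstract
    countable-⋃ : {I A : Set} {Q : Pred I 0ℓ} {R : I → Pred A 0ℓ} →
                  Countable Q → (∀ i → Countable (R i)) →
                  Countable (λ x → ∃[ i ] (i ∈ Q × x ∈ R i))
    countable-⋃ {I} {A} {Q} {R} (q , q-inj) r =
      -- The decision, which selects an index for `x`, is an argument of `code` so that injectivity
      -- can be proved by matching on it.
      (λ x → code x em₀) , λ {x} {y} → code-injective em₀ em₀
      where
      Union : Pred A 0ℓ
      Union x = ∃[ i ] (i ∈ Q × x ∈ R i)

      code : ∀ x → Dec (Union x) → ℕ
      code x (yes (i , _)) = pair (q i) (proj₁ (r i) x)
      code x (no _)        = 0

      code-injective : ∀ {x y} (dx : Dec (Union x)) (dy : Dec (Union y)) →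
                       Union x → Union y → code x dx ≡ code y dy → x ≡ y
      code-injective (no ∉∪) _ x∈∪ _ _ = contradiction x∈∪ ∉∪
      code-injective (yes _) (no ∉∪) _ y∈∪ _ = contradiction y∈∪ ∉∪
      code-injective (yes (i , i∈Q , x∈R)) (yes (j , j∈Q , y∈R)) _ _ eq
        with pair-injective (q i) _ (q j) _ eq
      ... | qi≡qj , eq′ with q-inj i∈Q j∈Q qi≡qj
      ... | refl = proj₂ (r i) x∈R y∈R eq′

  countable-image : {I A : Set} {Q : Pred I 0ℓ} (h : I → A) → Countable Q →
                    Countable (λ x → ∃[ i ] (i ∈ Q × h i ≡ x))
  countable-image h cQ = countable-⋃ cQ (countable-singleton ∘ h)

  countable-∪ : {A : Set} {P Q : Pred A 0ℓ} → Countable P → Countable Q → Countable (P ∪ Q)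
  countable-∪ {A} {P} {Q} cP cQ =
    countable-⊆ [ (λ x∈P → 0 , tt , x∈P) , (λ x∈Q → 1 , tt , x∈Q) ]′
      (countable-⋃ {R = R} countable-ℕ λ { zero → cP ; (ℕ.suc _) → cQ })
    where
    R : ℕ → Pred A 0ℓ
    R zero      = P
    R (ℕ.suc _) = Q

-- Bounds, closure points and stationary sets in ω₁.

module Ordinals (em₁ : ExcludedMiddle (suc 0ℓ)) (Ω : Omega₁) where
  open Classical em₁
  open Omega₁ Ω renaming (Carrier to Ord)

  module Ω< = IsStrictTotalOrder (proj₁ wellOrdered)

  <-trans : Transitive _<_
  <-trans = Ω<.trans

  <-irrefl : ∀ {α} → ¬ α < α
  <-irrefl = Ω<.irrefl refl

  <-cmp : Trichotomous _≡_ _<_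
  <-cmp α β = Ω<.compare (α , tt) (β , tt)

  <-wellFounded : WellFounded _<_
  <-wellFounded α = Acc-Σ⇒Acc _ (proj₂ wellOrdered (α , tt))

  least : {P : Pred Ord 0ℓ} → Satisfiable P → ∃[ α ] (α ∈ P × (∀ {β} → β < α → β ∉ P))
  least {P} (α , α∈P) = go α∈P (<-wellFounded α)
    where
    go : ∀ {α} → α ∈ P → Acc _<_ α → ∃[ β ] (β ∈ P × (∀ {γ} → γ < β → γ ∉ P))
    go {α} α∈P (acc rs) with em₀ {∃[ β ] (β < α × β ∈ P)}
    ... | yes (β , β<α , β∈P) = go β∈P (rs β<α)
    ... | no none = α , α∈P , λ β<α β∈P → none (_ , β<α , β∈P)

  countable-≮ : ∀ α → Countable (λ β → ¬ α < β)
  countable-≮ α = countable-⊆ split (countable-∪ (segments α) (countable-singleton α))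
    where
    split : (λ β → ¬ α < β) ⊆ ((_< α) ∪ (α ≡_))
    split {β} α≮β with <-cmp β α
    ... | tri< β<α _ _ = inj₁ β<α
    ... | tri≈ _ β≡α _ = inj₂ (sym β≡α)
    ... | tri> _ _ α<β = contradiction α<β α≮β

  StrictBound : Pred Ord 0ℓ → Pred Ord 0ℓ
  StrictBound P β = ∀ {α} → α ∈ P → α < β

  abstract
    -- Otherwise every `β` has some `α` in `P` with `¬ α < β`, and ω₁ becomes a countable union of
    -- countable sets.
    bounded : {P : Pred Ord 0ℓ} → Countable P → Satisfiable (StrictBound P)
    bounded {P} cP = decidable-stable em₀ λ unbounded →
      uncountable (countable-⊆ (λ {β} _ → above unbounded β) (countable-⋃ cP countable-≮))
      where
      above : ¬ Satisfiable (StrictBound P) → ∀ β → ∃[ α ] (α ∈ P × ¬ α < β)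
      above unbounded β = decidable-stable em₀ λ none →
        unbounded (β , λ α∈P → decidable-stable em₀ λ α≮β → none (_ , α∈P , α≮β))

  ClosedUnder : (Ord → Ord) → Pred Ord 0ℓ
  ClosedUnder F δ = ∀ {β} → β < δ → F β < δ

  -- The first factor rules out the least ordinal, which is vacuously closed under every function.
  ClosurePoint : (Ord → Ord) → Pred Ord 0ℓ
  ClosurePoint F δ = Satisfiable (_< δ) × ClosedUnder F δ

  -- Each `a (suc n)` exceeds `F` on everything up to `a n`. By minimality of `δ`, any `β < δ` is at
  -- most some `a n`, whence `F β < a (suc n) < δ`.
  closurePoint-unbounded : ∀ F → Unbounded Ω (ClosurePoint F)
  closurePoint-unbounded F α = δ , ((α , a<δ 0) , closed) , a<δ 0
    where
    G : ∀ β → Satisfiable (StrictBound (λ γ → ∃[ β′ ] (¬ β < β′ × F β′ ≡ γ)))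
    G β = bounded (countable-image F (countable-≮ β))

    a : ℕ → Ord
    a zero      = α
    a (ℕ.suc n) = proj₁ (G (a n))

    supremum = least (bounded (countable-image a countable-ℕ))

    δ : Ord
    δ = proj₁ supremum

    a<δ : ∀ n → a n < δ
    a<δ n = proj₁ (proj₂ supremum) (n , tt , refl)

    overtaken : ∀ {β} → β < δ → ∃[ n ] ¬ a n < β
    overtaken β<δ = counterexample em₀ em₀ λ β-bounds →
      proj₂ (proj₂ supremum) β<δ λ { (n , _ , refl) → β-bounds n }

    closed : ClosedUnder F δ
    closed {β} β<δ with overtaken β<δ
    ... | n , an≮β = <-trans (proj₂ (G (a n)) (β , an≮β , refl)) (a<δ (ℕ.suc n))

  closurePoint-club : ∀ F → Club Ω (ClosurePoint F)
  closurePoint-club F = limits , closurePoint-unbounded F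
    where
    limits : Closed Ω (ClosurePoint F)
    limits δ δ>0 cofinal = δ>0 , λ β<δ →
      let γ , (_ , closed) , β<γ , γ<δ = cofinal _ β<δ in <-trans (closed β<γ) γ<δ

  -- Every club C contains the closure points of any function sending each β to an
  -- element of C above β, so the sets ClosurePoint F generate the club filter.
  Reflecting : Pred Ord 0ℓ → Set
  Reflecting S = ∀ F → Satisfiable (S ∩ ClosurePoint F)

  stationary⇒reflecting : ∀ {S} → Stationary Ω S → Reflecting S
  stationary⇒reflecting stat F = stat (ClosurePoint F) (closurePoint-club F)

  reflecting⇒stationary : ∀ {S} → Reflecting S → Stationary Ω S
  reflecting⇒stationary reflect C (closed , unbounded) with reflect (proj₁ ∘ unbounded)
  ... | δ , δ∈S , δ>0 , δ-closed = δ , δ∈S ,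
    closed δ δ>0 λ β β<δ →
      proj₁ (unbounded β) , proj₁ (proj₂ (unbounded β)) ,
      proj₂ (proj₂ (unbounded β)) , δ-closed β<δ

  abstract
    -- Bounding each `P β` turns the family into a single function, so countably many closure
    -- conditions are met at one `δ`.
    reflect-countable : ∀ {S} → Reflecting S → {P : Ord → Pred Ord 0ℓ} → (∀ β → Countable (P β)) →
                        ∃[ δ ] (δ ∈ S × Satisfiable (_< δ) × (∀ {β} → β < δ → P β ⊆ (_< δ)))
    reflect-countable reflect {P} cP with reflect (λ β → proj₁ (bounded (cP β)))
    ... | δ , δ∈S , δ>0 , closed = δ , δ∈S , δ>0 , λ β<δ γ∈P →
      <-trans (proj₂ (bounded (cP _)) γ∈P) (closed β<δ)

  -- Ranks of well-founded orders with values in ω₁.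

  module Rank {A : Set} (_≺_ : Rel A 0ℓ)
              (≺-trans : Transitive _≺_) (≺-wellFounded : WellFounded _≺_) where

    -- The set-theoretic equation "rank of `t` = set of ranks of its predecessors". It is a relation
    -- because a rank below ω₁ need not exist.
    data HasRank (t : A) (α : Ord) : Set where
      hasRank : (∀ {s} → s ≺ t → ∃[ β ] (β < α × HasRank s β)) →
                (∀ {β} → β < α → ∃[ s ] (s ≺ t × HasRank s β)) → HasRank t α

    rank-unique : ∀ {t α β} → HasRank t α → HasRank t β → α ≡ β
    rank-unique {α = α} {β} (hasRank down up) (hasRank down′ up′) with <-cmp α β
    ... | tri≈ _ α≡β _ = α≡β
    ... | tri< α<β _ _ with up′ α<β
    ... | s , s≺t , s-α with down s≺t
    ... | γ , γ<α , s-γ with rank-unique s-γ s-α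
    ... | refl = contradiction γ<α <-irrefl
    rank-unique {α = α} {β} (hasRank down up) (hasRank down′ up′)
        | tri> _ _ β<α with up β<α
    ... | s , s≺t , s-β with down′ s≺t
    ... | γ , γ<β , s-γ with rank-unique s-β s-γ
    ... | refl = contradiction γ<β <-irrefl

    rank-mono : ∀ {s t α β} → s ≺ t → HasRank s α → HasRank t β → α < β
    rank-mono s≺t s-α (hasRank down _) with down s≺t
    ... | γ , γ<β , s-γ = subst (_< _) (rank-unique s-γ s-α) γ<β

    -- A predecessor of rank above `α` would itself have a predecessor of rank `α`, which by
    -- transitivity lies below `t`.
    leastMissing⇒rank : ∀ {t α} → (∀ {s} → s ≺ t → Satisfiable (HasRank s)) →
                        ¬ (∃[ s ] (s ≺ t × HasRank s α)) →
                        (∀ {β} → β < α → ∃[ s ] (s ≺ t × HasRank s β)) → HasRank t α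
    leastMissing⇒rank {t} {α} ranked missing = hasRank down
      where
      down : ∀ {s} → s ≺ t → ∃[ β ] (β < α × HasRank s β)
      down s≺t with ranked s≺t
      ... | γ , s-γ with <-cmp γ α
      ... | tri< γ<α _ _ = γ , γ<α , s-γ
      ... | tri≈ _ refl _ = contradiction (_ , s≺t , s-γ) missing
      ... | tri> _ _ α<γ with s-γ
      ... | hasRank _ up with up α<γ
      ... | r , r≺s , r-α = contradiction (r , ≺-trans r≺s s≺t , r-α) missing

    module Total (countableRank : ∀ t → (∀ {s} → s ≺ t → Satisfiable (HasRank s)) →
                    ¬ (∀ α → ∃[ s ] (s ≺ t × HasRank s α))) where

      abstract
        ranked : ∀ t → Satisfiable (HasRank t)
        ranked = All.wfRec ≺-wellFounded 0ℓ (Satisfiable ∘ HasRank) λ t ih →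
          let α , missing , below = least (counterexample em₀ em₀ (countableRank t ih))
          in α , leastMissing⇒rank ih missing (decidable-stable em₀ ∘ below)

      ht : A → Ord
      ht t = proj₁ (ranked t)

      ht-mono : ∀ {s t} → s ≺ t → ht s < ht t
      ht-mono s≺t = rank-mono s≺t (proj₂ (ranked _)) (proj₂ (ranked _))

      ht-unique : ∀ {t α} → HasRank t α → ht t ≡ α
      ht-unique = rank-unique (proj₂ (ranked _))

      ht-onto : ∀ {t α} → α < ht t → ∃[ s ] (s ≺ t × ht s ≡ α)
      ht-onto {t} α<ht with proj₂ (ranked t)
      ... | hasRank _ up with up α<ht
      ... | s , s≺t , s-α = s , s≺t , ht-unique s-α

  -- The injection is the rank function of the lexicographic order.
  abstract
    ordPair : Σ (Ord → ℕ → Ord) λ c →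
              ∀ {α β m n} → c α m ≡ c β n → α ≡ β × m ≡ n
    ordPair = (λ α n → ht (α , n)) , injective
      where
      _≺_ : Rel (Ord × ℕ) 0ℓ
      _≺_ = ×-Lex _≡_ _<_ _<ℕ_

      open Rank _≺_
        (×-transitive {_<₁_ = _<_} {_<ℕ_} isEquivalence (resp₂ _<_) <-trans <ℕ-trans)
        (×-wellFounded <-wellFounded <ℕ-wellFounded)

      countable-≺ : ∀ t → Countable (_≺ t)
      countable-≺ (α , n) = countable-⊆ below
        (countable-⋃ {R = λ β x → proj₁ x ≡ β} (countable-≮ α)
          λ β → proj₂ , λ { {_ , m} refl refl refl → refl })
        where
        below : (_≺ (α , n)) ⊆ (λ x → ∃[ β ] (¬ α < β × proj₁ x ≡ β))
        below (inj₁ β<α)        = _ , (λ α<β → <-irrefl (<-trans α<β β<α)) , refl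
        below (inj₂ (refl , _)) = _ , <-irrefl , refl

      countableRank : ∀ t → (∀ {s} → s ≺ t → Satisfiable (HasRank s)) →
                      ¬ (∀ α → ∃[ s ] (s ≺ t × HasRank s α))
      countableRank t _ cover = uncountable
        (countable-⊆ (λ {α} _ → cover α)
          (countable-⋃ (countable-≺ t) λ s → countable-subsingleton rank-unique))

      open Total countableRank

      distinct : ∀ {s t} → s ≺ t → ht s ≢ ht t
      distinct s≺t eq = <-irrefl (subst (_< _) eq (ht-mono s≺t))

      injective : ∀ {α β m n} → ht (α , m) ≡ ht (β , n) → α ≡ β × m ≡ n
      injective {α} {β} {m} {n} eq with <-cmp α β
      ... | tri< α<β _ _ = contradiction eq (distinct (inj₁ α<β))
      ... | tri> _ _ β<α = contradiction (sym eq) (distinct (inj₁ β<α))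
      ... | tri≈ _ refl _ with <ℕ-cmp m n
      ... | tri< m<n _ _ = contradiction eq (distinct (inj₂ (refl , m<n)))
      ... | tri≈ _ m≡n _ = refl , m≡n
      ... | tri> _ _ n<m = contradiction (sym eq) (distinct (inj₂ (refl , n<m)))

-- Heights and levels of an ω₁-tree.

module Heights (em₁ : ExcludedMiddle (suc 0ℓ)) (Ω : Omega₁) (T : Tree)
               (ω₁-tree : IsOmega₁Tree T Ω) where
  open Classical em₁
  open Ordinals em₁ Ω
  open Omega₁ Ω using (_<_) renaming (Carrier to Ord)
  open Tree T renaming (_<_ to _<ᵗ_)

  module T< = IsStrictPartialOrder isStrictPartialOrder

  <ᵗ-wellFounded : WellFounded _<ᵗ_
  <ᵗ-wellFounded t =
    acc λ s<t → Acc-Σ⇒Acc T<.trans (proj₂ (↓-wellOrdered t) (_ , s<t))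

  open Rank _<ᵗ_ T<.trans <ᵗ-wellFounded

  -- Rank is the isomorphism: it is strictly monotone, and comparability of the predecessors of `t`
  -- lets it be reversed. Initial segments `P` give the levels below ω₁, and `U` gives level ω₁.
  ranks⇒sameOrderType : ∀ {t} {P : Pred Ord 0ℓ} →
                        (∀ {s} → s <ᵗ t → ∃[ α ] (α ∈ P × HasRank s α)) →
                        (∀ {α} → α ∈ P → ∃[ s ] (s <ᵗ t × HasRank s α)) →
                        SameOrderType _<ᵗ_ (t ↓) _<_ P
  ranks⇒sameOrderType {t} {P} down up = f , record
    { isOrderMonomorphism = record
      { isOrderHomomorphism = record
        { cong = λ {x} {y} → f-cong x y
        ; mono = λ {x} {y} → f-mono x y
        }
      ; injective = λ {x} {y} → f-injective x y
      ; cancel    = λ {x} {y} → f-cancel x y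
      }
    ; surjective = f-surjective
    }
    where
    open IsStrictTotalOrder (proj₁ (↓-wellOrdered t)) using (compare)

    f : Σ Node (t ↓) → Σ Ord P
    f (_ , s<t) = let α , α∈P , _ = down s<t in α , α∈P

    f-rank : ∀ x → HasRank (proj₁ x) (proj₁ (f x))
    f-rank (_ , s<t) = proj₂ (proj₂ (down s<t))

    f-cong : ∀ x y → proj₁ x ≡ proj₁ y → proj₁ (f x) ≡ proj₁ (f y)
    f-cong x y refl = rank-unique (f-rank x) (f-rank y)

    f-mono : ∀ x y → proj₁ x <ᵗ proj₁ y → proj₁ (f x) < proj₁ (f y)
    f-mono x y x<y = rank-mono x<y (f-rank x) (f-rank y)

    f-injective : ∀ x y → proj₁ (f x) ≡ proj₁ (f y) → proj₁ x ≡ proj₁ y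
    f-injective x y eq with compare x y
    ... | tri< x<y _ _ = contradiction (subst (_< proj₁ (f y)) eq (f-mono x y x<y)) <-irrefl
    ... | tri≈ _ x≡y _ = x≡y
    ... | tri> _ _ y<x = contradiction (subst (proj₁ (f y) <_) eq (f-mono y x y<x)) <-irrefl

    f-cancel : ∀ x y → proj₁ (f x) < proj₁ (f y) → proj₁ x <ᵗ proj₁ y
    f-cancel x y fx<fy with compare x y
    ... | tri< x<y _ _ = x<y
    ... | tri≈ _ x≡y _ = contradiction (subst (_< proj₁ (f y)) (f-cong x y x≡y) fx<fy) <-irrefl
    ... | tri> _ _ y<x = contradiction (<-trans fx<fy (f-mono y x y<x)) <-irrefl

    f-surjective : ∀ y → ∃[ x ] (∀ {z} → proj₁ z ≡ proj₁ x → proj₁ (f z) ≡ proj₁ y)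
    f-surjective (α , α∈P) with up α∈P
    ... | s , s<t , s-α = (s , s<t) , λ { {z} refl → rank-unique (f-rank z) s-α }

  -- By induction on `s`, the isomorphism sends each `s` below `t` to its rank, since it maps the
  -- predecessors of `s` onto the ordinals below the image of `s`.
  level⇒rank : ∀ {t α} → Level T Ω α t → HasRank t α
  level⇒rank {t} {α} (φ , iso) = hasRank
    (λ s<t → _ , proj₂ (φ (_ , s<t)) , below (<ᵗ-wellFounded _) s<t)
    λ β<α → let (s , s<t) , eq = surjective (_ , β<α) in
      s , s<t , subst (HasRank s) (eq refl) (below (<ᵗ-wellFounded s) s<t)
    where
    open IsOrderIsomorphism iso using (mono; cancel; surjective)

    below : ∀ {s} → Acc _<ᵗ_ s → (s<t : s <ᵗ t) → HasRank s (proj₁ (φ (s , s<t)))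
    below {s} (acc rs) s<t = hasRank
      (λ r<s → let r<t = T<.trans r<s s<t in
        _ , mono {_ , r<t} {_ , s<t} r<s , below (rs r<s) r<t)
      λ β<φs →
        let (r , r<t) , eq = surjective (_ , <-trans β<φs (proj₂ (φ (s , s<t))))
            r<s = cancel {r , r<t} {s , s<t} (subst (_< _) (sym (eq refl)) β<φs)
        in r , r<s , subst (HasRank r) (eq refl) (below (rs r<s) r<t)

  -- Such a node would lie on level ω₁, which is empty.
  countableRank : ∀ t → (∀ {s} → s <ᵗ t → Satisfiable (HasRank s)) →
                  ¬ (∀ α → ∃[ s ] (s <ᵗ t × HasRank s α))
  countableRank t ranked cover = proj₂ (proj₁ ω₁-tree)
    (t , ranks⇒sameOrderType (λ s<t → map₂ (tt ,_) (ranked s<t)) (λ {α} _ → cover α))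

  open Total countableRank public using (ranked; ht; ht-mono; ht-unique; ht-onto)

  abstract
    level-nonempty : ∀ α → ∃[ t ] ht t ≡ α
    level-nonempty α = map₂ (ht-unique ∘ level⇒rank) (proj₁ (proj₁ ω₁-tree) α)

    level-countable : ∀ α → Countable (λ t → ht t ≡ α)
    level-countable α =
      countable-⊆ (λ { {t} refl → rank⇒level (proj₂ (ranked t)) }) (proj₂ ω₁-tree α)
      where
      rank⇒level : ∀ {t} → HasRank t α → Level T Ω α t
      rank⇒level (hasRank down up) = ranks⇒sameOrderType down up

  countable-ht≮ : ∀ α → Countable (λ t → ¬ α < ht t)
  countable-ht≮ α = countable-⊆ (λ α≮ht → _ , α≮ht , refl)
    (countable-⋃ {R = λ β t → ht t ≡ β} (countable-≮ α) level-countable)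

  abstract
    nodeCode : Σ (Node → Ord) λ code → ∀ {s t} → code s ≡ code t → s ≡ t
    nodeCode = (λ t → proj₁ ordPair (ht t) (index (ht t) t)) , λ eq →
      let hts≡htt , is≡it = proj₂ ordPair eq in sameIndex refl refl hts≡htt is≡it
      where
      index : Ord → Node → ℕ
      index α = proj₁ (level-countable α)

      -- The heights are generalised to variables so that their equality can be matched with `refl`.
      sameIndex : ∀ {s t α β} → ht s ≡ α → ht t ≡ β → α ≡ β → index α s ≡ index β t → s ≡ t
      sameIndex {α = α} s-α t-α refl = proj₂ (level-countable α) s-α t-α

-- Special sets and the ideal NSᵀ in a Suslin tree.

module Suslin (em₁ : ExcludedMiddle (suc 0ℓ)) (Ω : Omega₁) (T : Tree)
              (suslin : IsSuslin T Ω) where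
  open Classical em₁
  open Ordinals em₁ Ω
  open Omega₁ Ω using (_<_) renaming (Carrier to Ord)
  open Tree T renaming (_<_ to _<ᵗ_)
  open Heights em₁ Ω T (proj₁ suslin)

  special⇒countable : ∀ {S} → Special T S → Countable S
  special⇒countable (A , antichain , S⊆⋃ , _) =
    countable-⊆ (λ s∈S → map₂ (tt ,_) (S⊆⋃ s∈S)) (countable-⋃ countable-ℕ λ n →
      decidable-stable em₀ λ uncountable →
        proj₂ (proj₂ suslin) (A n , antichain n , uncountable))

  -- Each fibre of the injection has at most one node, hence is an antichain.
  countable⇒special : ∀ {S} → Countable S → Special T S
  countable⇒special {S} (f , f-inj) =
    (λ n t → t ∈ S × f t ≡ n) ,
    (λ { n (s∈S , refl) (t∈S , eq) s≢t → contradiction (f-inj s∈S t∈S (sym eq)) s≢t }) ,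
    (λ {t} t∈S → f t , t∈S , refl) ,
    λ (_ , t∈S , _) → t∈S

  heights : Pred Node 0ℓ → Pred Ord 0ℓ
  heights B α = ∃[ t ] (t ∈ B × ht t ≡ α)

  -- Fibres and levels are countable, so only countably many heights come from nodes that `f` sends
  -- to level `β`. If `ht t` is closed under bounds for these, then `f t <ᵗ t` yields `ht t < ht t`.
  reflecting⇒¬NS : ∀ {B} → Reflecting (heights B) → ¬ NS T B
  reflecting⇒¬NS {B} reflect (f , regressive , special)
    with reflect-countable reflect (λ β → countable-image ht
           (countable-⋃ {R = λ s t → t ∈ B × f t ≡ s} (level-countable β)
             (special⇒countable ∘ special)))
  ... | _ , (t , t∈B , refl) , (_ , β<ht) , closed =
    <-irrefl (closed (ht-mono ft<t) (t , (f t , refl , t∈B , refl) , refl))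
    where
    t≢root : t ≢ root
    t≢root refl with ht-onto β<ht
    ... | s , s<root , _ = T<.asym s<root (root-least s λ { refl → T<.irrefl refl s<root })

    ft<t : f t <ᵗ t
    ft<t = regressive t∈B t≢root

  -- If no height of a node of `B` is a closure point of `F`, press each `t` to a predecessor `s`
  -- witnessing the failure. The fibre over `s` then has heights at most `F (ht s)`, so it is
  -- countable.
  ¬NS⇒reflecting : ∀ {B} → ¬ NS T B → Reflecting (heights B)
  ¬NS⇒reflecting {B} ¬ns F = decidable-stable em₀ λ none →
    ¬ns ( (proj₁ ∘ press none)
        , (λ {t} t∈B → proj₂ (proj₂ (press none t) t∈B))
        , λ s → countable⇒special (countable-⊆
            (λ { {t} (t∈B , refl) → proj₁ (proj₂ (press none t) t∈B) })
            (countable-ht≮ (F (ht s)))) )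
    where
    press : ¬ Satisfiable (heights B ∩ ClosurePoint F) → ∀ t →
            ∃[ s ] (t ∈ B → ¬ F (ht s) < ht t × (t ≢ root → s <ᵗ t))
    press none t with em₀ {∃[ s ] (s <ᵗ t × ¬ F (ht s) < ht t)}
    ... | yes (s , s<t , F≮ht) = s , λ _ → F≮ht , λ _ → s<t
    -- Here `ht t` is closed under `F`, so by `none` a node `t` of `B` has no predecessors. It is
    -- therefore the root, which regressiveness exempts.
    ... | no closed = t , λ t∈B →
      (λ F<ht → let _ , s<t , _ = ht-onto F<ht in minimal t∈B s<t) ,
      λ t≢root → contradiction (root-least t t≢root) (minimal t∈B)
      where
      closedUnder : ClosedUnder F (ht t)
      closedUnder β<ht with ht-onto β<ht
      ... | s , s<t , refl = decidable-stable em₀ λ F≮ht → closed (s , s<t , F≮ht)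

      minimal : t ∈ B → ∀ {s} → ¬ s <ᵗ t
      minimal t∈B s<t = none
        (ht t , (t , t∈B , refl) , (_ , ht-mono s<t) , closedUnder)

  -- Transfer between the two diamond principles.

  ◇⇒◇ᵀ : ◇ Ω → ◇ᵀ T
  ◇⇒◇ᵀ (D , _ , guess) =
    (λ t s → s <ᵗ t × code s ∈ D (ht t)) , (λ t → proj₁) ,
    λ X → reflecting⇒¬NS (reflecting X)
    where
    code : Node → Ord
    code = proj₁ nodeCode

    reflecting : ∀ X → Reflecting
      (heights λ t → (X ∩ (t ↓)) ≐ (λ s → s <ᵗ t × code s ∈ D (ht t)))
    reflecting X F
      with reflect-countable (stationary⇒reflecting (guess λ α → ∃[ s ] (s ∈ X × code s ≡ α)))
             -- Besides `F`, `δ` is closed under codes of nodes on earlier levels: the guess at `δ`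
             -- sees only codes below `δ`.
             {λ β → (F β ≡_) ∪ (λ α → ∃[ s ] (ht s ≡ β × code s ≡ α))}
             (λ β → countable-∪ (countable-singleton (F β))
                                (countable-image code (level-countable β)))
    ... | δ , (X⊆D , D⊆X) , δ>0 , closed with level-nonempty δ
    ... | t , refl = ht t ,
      ( t
      , ( (λ (s∈X , s<t) → s<t ,
            X⊆D ((_ , s∈X , refl) , closed (ht-mono s<t) (inj₂ (_ , refl , refl))))
        , λ (s<t , s∈D) →
            let (r , r∈X , eq) , _ = D⊆X s∈D in subst X (proj₂ nodeCode eq) r∈X , s<t )
      , refl ) ,
      δ>0 , λ β<ht → closed β<ht (inj₁ refl)

  -- As in Kunen's proof that ◇⁻ implies ◇: the countably many nodes of a level
  -- yield countably many guesses, a counterexample Xₙ for each n would be coded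
  -- by the single set {s ∣ ht s ∈ c (Xₙ × {n}) for some n}, and the node guessing
  -- this set, being the n-th of its level for some n, guesses Xₙ.
  ◇ᵀ⇒◇ : ◇ᵀ T → ◇ Ω
  ◇ᵀ⇒◇ (D , D⊆↓ , guess) =
    let n , reflecting = some-index
    in E n , (λ α → proj₁) , λ X → reflecting⇒stationary (reflecting X)
    where
    c : Ord → ℕ → Ord
    c = proj₁ ordPair

    index : Ord → Node → ℕ
    index α = proj₁ (level-countable α)

    E : ℕ → Ord → Pred Ord 0ℓ
    -- The guess is empty when no node of level `α` has index `n`.
    E n α ξ = ξ < α × ∃[ t ] (ht t ≡ α × index α t ≡ n × ∃[ s ] (s ∈ D t × ht s ≡ c ξ n))

    Guesses : ℕ → Pred Ord 0ℓ → Pred Ord 0ℓ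
    Guesses n X α = (X ∩ (_< α)) ≐ E n α

    no-counterexamples : ¬ (∀ n → ∃[ X ] ¬ Reflecting (Guesses n X))
    no-counterexamples counterexamples = refute
      (reflect-countable (¬NS⇒reflecting (guess Coded))
        -- One `δ` must serve all `n` at once, because the index of the guessing node is known only
        -- after `δ` is found.
        (λ β → countable-⋃ {R = λ n γ → F n β ≡ γ ⊎ c β n ≡ γ} countable-ℕ
          λ n → countable-∪ (countable-singleton (F n β)) (countable-singleton (c β n))))
      where
      X : ℕ → Pred Ord 0ℓ
      X n = proj₁ (counterexamples n)

      evasion : ∀ n → ∃[ F ] ¬ Satisfiable (Guesses n (X n) ∩ ClosurePoint F)
      evasion n = counterexample em₀ em₀ (proj₂ (counterexamples n))

      F : ℕ → Ord → Ord
      F n = proj₁ (evasion n)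

      Coded : Pred Node 0ℓ
      Coded s = ∃[ n ] ∃[ ξ ] (ξ ∈ X n × c ξ n ≡ ht s)

      refute : ¬ (∃[ δ ] (δ ∈ heights (λ t → (Coded ∩ (t ↓)) ≐ D t) × Satisfiable (_< δ) ×
                 (∀ {β} → β < δ → (λ γ → ∃[ n ] (n ∈ U × (F n β ≡ γ ⊎ c β n ≡ γ))) ⊆ (_< δ))))
      refute (_ , (t , (coded⊆D , D⊆coded) , refl) , δ>0 , closed) = proj₂ (evasion n)
        (ht t , (X⊆E , E⊆X) , δ>0 , λ β<ht → closed β<ht (n , tt , inj₁ refl))
        where
        n : ℕ
        n = index (ht t) t

        X⊆E : (X n ∩ (_< ht t)) ⊆ E n (ht t)
        -- Closure puts `c ξ n` below `ht t`, so it is the height of a predecessor of `t`, which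
        -- lies in `Coded`.
        X⊆E {ξ} (ξ∈X , ξ<ht) with ht-onto (closed ξ<ht (n , tt , inj₂ refl))
        ... | s , s<t , eq =
          ξ<ht , t , refl , refl , s , coded⊆D ((n , ξ , ξ∈X , sym eq) , s<t) , eq

        E⊆X : E n (ht t) ⊆ (X n ∩ (_< ht t))
        E⊆X (ξ<ht , u , hu≡ht , iu≡it , s , s∈D , hs≡c)
          -- The index identifies `u` with `t`; injectivity of `c` then recovers both `n` and `ξ`
          -- from the height of `s`.
          with proj₂ (level-countable (ht t)) hu≡ht refl iu≡it
        ... | refl with D⊆coded s∈D
        ... | (m , η , η∈X , c≡hs) , _ with proj₂ ordPair (trans c≡hs hs≡c)
        ... | refl , refl = η∈X , ξ<ht

    some-index : ∃[ n ] (∀ X → Reflecting (Guesses n X))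
    some-index = decidable-stable em₁ λ none →
      no-counterexamples λ n → counterexample em₁ em₀ λ reflecting → none (n , reflecting)

corollary4p14 : ExcludedMiddle (suc 0ℓ) →
    (Ω : Omega₁) (T : Tree) → IsSuslin T Ω → ◇ᵀ T ⇔ ◇ Ω
corollary4p14 em Ω T suslin = mk⇔ ◇ᵀ⇒◇ ◇⇒◇ᵀ
  where open Suslin em Ω T suslin
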